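{- Let $N$ be a set, let $n$ be a natural number, and let $\overline{X}=(X_1,\dots,X_n)$ and $\overline{Y}=(Y_1,\dots,Y_n)$ be $n$-tuples of nonempty subsets of $N$. Then $$\overline{X}\approx\overline{Y}\quad\Longleftrightarrow\quad \text{there exists } \sigma\in S_n \text{ such that } \sigma\cdot\overline{X}=\overline{Y}.$$
   Context: $S_n$ is the symmetric group on $\{1,\dots,n\}$; it acts on $n$-tuples by $\sigma\cdot(a_1,\dots,a_n)=(a_{\sigma^{ -1}(1)},\dots,a_{\sigma^{ -1}(n)})$. An $n$-multiset of elements of $N$ is an orbit of this action on $N^n$. For an $n$-tuple $\overline{X}=(X_1,\dots,X_n)$ of nonempty subsets of $N$, the set $\mathcal{S}(\overline{X})$ of (unordered) sections of $\overline{X}$ is the set of all $n$-multisets that are orbits of tuples $(a_1,\dots,a_n)\in\prod_{1\le i\le n}X_i$. For two $n$-tuples of nonempty subsets of $N$, $\overline{X}\sqsubseteq\overline{Y}$ means $\mathcal{S}(\overline{X})\subseteq\mathcal{S}(\overline{Y})$, and $\overline{X}\approx\overline{Y}$ means $\overline{X}\sqsubseteq\overline{Y}$ and $\overline{Y}\sqsubseteq\overline{X}$, i.e. $\mathcal{S}(\overline{X})=\mathcal{S}(\overline{Y})$. -}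

module Defs where

open import Level using (Level; suc; _⊔_)
open import Data.Nat.Base using (ℕ)
open import Data.Fin.Permutation using (Permutation′; _⟨$⟩ˡ_)
open import Data.Product.Base using (∃; _×_)
open import Data.Vec.Functional using (Vector; rearrange)
open import Data.Vec.Functional.Relation.Binary.Pointwise using (Pointwise)
open import Relation.Binary.PropositionalEquality using (_≡_)
open import Relation.Unary using (Pred; _∈_; _⊆_; _≐_)

private
  variable
    a ℓ : Level
    A : Set a
    n : ℕ

infixr 8 _·_
infix 4 _⊑_ _≈_

-- `σ ⟨$⟩ˡ i` is σ⁻¹(i).
_·_ : Permutation′ n → Vector A n → Vector A n
σ · t = rearrange (σ ⟨$⟩ˡ_) t

-- Tuples are functions on Fin n, so their equality is taken pointwise.
Orbit : {N : Set a} → Vector N n → Pred (Vector N n) a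
Orbit t s = ∃ λ σ → Pointwise _≡_ (σ · t) s

record Multiset (N : Set a) (n : ℕ) : Set (suc a) where
  field
    tuples  : Pred (Vector N n) a
    isOrbit : ∃ λ t → tuples ≐ Orbit t

open Multiset public

∏ : {N : Set a} → Vector (Pred N ℓ) n → Pred (Vector N n) ℓ
∏ X t = ∀ i → t i ∈ X i

𝒮 : {N : Set a} → Vector (Pred N ℓ) n → Pred (Multiset N n) (a ⊔ ℓ)
𝒮 X M = ∃ λ t → t ∈ ∏ X × tuples M ≐ Orbit t

_⊑_ : {N : Set a} → Vector (Pred N ℓ) n → Vector (Pred N ℓ) n → Set (suc a ⊔ ℓ)
X ⊑ Y = 𝒮 X ⊆ 𝒮 Y

_≈_ : {N : Set a} → Vector (Pred N ℓ) n → Vector (Pred N ℓ) n → Set (suc a ⊔ ℓ)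
X ≈ Y = X ⊑ Y × Y ⊑ X

{-# OPTIONS --safe #-}

-- For A ⊆ N, the number of i with Xᵢ ⊆ A is the least number of entries in A
-- of a section of X, so it is determined by 𝒮 X. These numbers determine X up to
-- permutation: starting from any Xᵢ, equality of the counts yields a descending
-- chain Xᵢ ⊇ Yⱼ ⊇ Xₖ ⊇ …, which stabilises because only finitely many sets occur;
-- this gives some Xₖ ≐ Yⱼ, and removing both leaves tuples with equal counts.

module Submission where

open import Defs
open import Level using (Level; _⊔_; Lift; lift; lower)
open import Algebra.Properties.CommutativeMonoid.Sum using (sum-remove; ∑-permute)
open import Axiom.ExcludedMiddle using (ExcludedMiddle)
open import Data.Bool.Base using (if_then_else_)
open import Data.Empty using (⊥-elim)
open import Data.Fin.Base using (Fin; zero; suc)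
open import Data.Fin.Induction using (po-wellFounded)
open import Data.Fin.Permutation as Perm
  using (Permutation′; _⟨$⟩ˡ_; _⟨$⟩ʳ_; flip; insert; inverseˡ; _∘ₚ_)
open import Data.Fin.Properties using (punchIn-punchOut; _≟_)
open import Data.Nat.Base as ℕ using (ℕ; zero; suc; z≤n; s≤s; _+_)
open import Data.Nat.Properties as ℕ using (+-0-commutativeMonoid)
open import Data.Product.Base using (∃; ∃₂; _×_; _,_; proj₁; proj₂)
open import Data.Vec.Functional using (Vector; foldr; map; removeAt)
open import Data.Vec.Functional.Relation.Unary.All using (All)
open import Data.Vec.Functional.Relation.Binary.Pointwise using (Pointwise)
open import Function.Base using (_∘_; _on_)
open import Function.Bundles using (_⇔_; mk⇔)
open import Induction.WellFounded using (Acc; acc)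
open import Relation.Binary.Bundles using (Poset)
open import Relation.Binary.Definitions as B using ()
import Relation.Binary.Construct.NonStrictToStrict as ToStrict
import Relation.Binary.Construct.On as On
open import Relation.Binary.PropositionalEquality
  using (_≡_; refl; sym; trans; cong; subst; module ≡-Reasoning)
open import Relation.Nullary.Decidable using (Dec; yes; no; does; map′; decidable-stable)
open import Relation.Unary using (Pred; Satisfiable; Decidable; _∈_; _⊆_; _≐_)
open import Relation.Unary.Relation.Binary.Subset using (⊆-poset)

private
  variable
    a p ℓ : Level
    A : Set a
    P Q : Set p
    n : ℕ

indicator : Dec P → ℕ
indicator P? = if does P? then 1 else 0

indicator-mono : (P? : Dec P) (Q? : Dec Q) → (P → Q) → indicator P? ℕ.≤ indicator Q?
indicator-mono (yes x) (yes _) f = ℕ.≤-refl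
indicator-mono (yes x) (no ¬q) f = ⊥-elim (¬q (f x))
indicator-mono (no _)  _       f = z≤n

sum : Vector ℕ n → ℕ
sum = foldr _+_ 0

sum-mono : (f g : Vector ℕ n) → Pointwise ℕ._≤_ f g → sum f ℕ.≤ sum g
sum-mono {n = zero}  f g f≤g = z≤n
sum-mono {n = suc n} f g f≤g =
  ℕ.+-mono-≤ (f≤g zero) (sum-mono (f ∘ suc) (g ∘ suc) (f≤g ∘ suc))

count : {P : Pred A p} → Decidable P → Vector A n → ℕ
count P? x = sum (map (indicator ∘ P?) x)

module _ {P : Pred A p} (P? : Decidable P) where

  count-remove : (x : Vector A (suc n)) (i : Fin (suc n)) →
    count P? x ≡ indicator (P? (x i)) + count P? (removeAt x i)
  count-remove x i = sum-remove +-0-commutativeMonoid (map (indicator ∘ P?) x)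

  count-positive : (x : Vector A n) (i : Fin n) → P (x i) → 0 ℕ.< count P? x
  count-positive {n = suc _} x i Pxᵢ rewrite count-remove x i with P? (x i)
  ... | yes _   = s≤s z≤n
  ... | no ¬Pxᵢ = ⊥-elim (¬Pxᵢ Pxᵢ)

  count-positive⁻¹ : (x : Vector A n) → 0 ℕ.< count P? x → ∃ λ i → P (x i)
  count-positive⁻¹ {n = suc _} x 0<c with P? (x zero)
  ... | yes Px₀ = zero , Px₀
  ... | no _    with i , Pxᵢ ← count-positive⁻¹ (x ∘ suc) 0<c = suc i , Pxᵢ

  -- Reindexing along `π` leaves the sum for `y` unchanged, after which the two sums compare term by
  -- term.
  count-mono-permute : (x y : Vector A n) (π : Permutation′ n) →
    (∀ i → P (x i) → P (y (π ⟨$⟩ʳ i))) → count P? x ℕ.≤ count P? y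
  count-mono-permute x y π h = subst (count P? x ℕ.≤_)
    (sym (∑-permute +-0-commutativeMonoid (map (indicator ∘ P?) y) π))
    (sum-mono _ _ λ i → indicator-mono (P? (x i)) (P? (y (π ⟨$⟩ʳ i))) (h i))

module _ {c ℓ₁ ℓ₂} (𝑷 : Poset c ℓ₁ ℓ₂) (_≤?_ : B.Decidable (Poset._≤_ 𝑷)) where

  open Poset 𝑷 using (Carrier; _≤_; module Eq; reflexive; antisym; isPartialOrder)
    renaming (_≈_ to _≃_; refl to ≤-refl; trans to ≤-trans)

  countBelow : Carrier → Vector Carrier n → ℕ
  countBelow b = count (_≤? b)

  match : (x y : Vector Carrier (suc n)) →
    (∀ b → countBelow b x ≡ countBelow b y) → ∃₂ λ k j → x k ≃ y j
  -- The strict order is pulled back along `x` to the finite set of indices, where it is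
  -- well-founded whatever the poset.
  match x y same = descend zero (po-wellFounded (On.isPartialOrder x isPartialOrder) zero)
    where
    descend : ∀ i → Acc (ToStrict._<_ (_≃_ on x) (_≤_ on x)) i → ∃₂ λ k j → x k ≃ y j
    descend i (acc smaller)
      with j , yⱼ≤xᵢ ← count-positive⁻¹ (_≤? x i) y
             (subst (0 ℕ.<_) (same (x i)) (count-positive (_≤? x i) x i ≤-refl))
      with k , xₖ≤yⱼ ← count-positive⁻¹ (_≤? y j) x
             (subst (0 ℕ.<_) (sym (same (y j))) (count-positive (_≤? y j) y j ≤-refl))
      -- Now `x k ≤ y j ≤ x i`. A reverse inequality collapses the chain; otherwise `x k` is
      -- strictly below `x i` and the search resumes at `k`.
      with x i ≤? x k
    ... | yes xᵢ≤xₖ = k , j , antisym xₖ≤yⱼ (≤-trans yⱼ≤xᵢ xᵢ≤xₖ)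
    ... | no  xᵢ≰xₖ = descend k (smaller
      (≤-trans xₖ≤yⱼ yⱼ≤xᵢ , λ xₖ≃xᵢ → xᵢ≰xₖ (reflexive (Eq.sym xₖ≃xᵢ))))

  indicator-≃ : ∀ {u v} b → u ≃ v → indicator (u ≤? b) ≡ indicator (v ≤? b)
  indicator-≃ {u} {v} b u≃v = ℕ.≤-antisym
    (indicator-mono (u ≤? b) (v ≤? b) (≤-trans (reflexive (Eq.sym u≃v))))
    (indicator-mono (v ≤? b) (u ≤? b) (≤-trans (reflexive u≃v)))

  removeAt-countBelow : (x y : Vector Carrier (suc n)) {k j : Fin (suc n)} → x k ≃ y j →
    (∀ b → countBelow b x ≡ countBelow b y) →
    ∀ b → countBelow b (removeAt x k) ≡ countBelow b (removeAt y j)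
  removeAt-countBelow x y {k} {j} xₖ≃yⱼ same b =
    ℕ.+-cancelˡ-≡ (indicator (y j ≤? b)) _ _ (begin
      indicator (y j ≤? b) + countBelow b (removeAt x k)
        ≡⟨ cong (_+ countBelow b (removeAt x k)) (indicator-≃ b xₖ≃yⱼ) ⟨
      indicator (x k ≤? b) + countBelow b (removeAt x k)
        ≡⟨ count-remove (_≤? b) x k ⟨
      countBelow b x
        ≡⟨ same b ⟩
      countBelow b y
        ≡⟨ count-remove (_≤? b) y j ⟩
      indicator (y j ≤? b) + countBelow b (removeAt y j) ∎)
    where open ≡-Reasoning

  countBelow-determines : (x y : Vector Carrier n) →
    (∀ b → countBelow b x ≡ countBelow b y) →
    ∃ λ (σ : Permutation′ n) → Pointwise _≃_ (σ · x) y
  countBelow-determines {n = zero}  x y same = Perm.id , λ ()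
  countBelow-determines {n = suc _} x y same
    with k , j , xₖ≃yⱼ ← match x y same
    with τ , τx≃y ← countBelow-determines (removeAt x k) (removeAt y j)
                      (removeAt-countBelow x y xₖ≃yⱼ same)
    -- The inserted permutation sends `j` to `k` and acts as the inverse of `τ` elsewhere. It maps
    -- indices of `y` to indices of `x`, so it is the inverse of the required `σ`, because `σ · x`
    -- reads `x` through the inverse of `σ`.
    = flip (insert j k (flip τ)) , pointwise
    where
    pointwise : ∀ l → x (insert j k (flip τ) ⟨$⟩ʳ l) ≃ y l
    pointwise l with j ≟ l
    ... | yes refl = xₖ≃yⱼ
    ... | no  j≢l  = Eq.trans (τx≃y _) (Eq.reflexive (cong y (punchIn-punchOut j≢l)))

-- Inclusions of subsets live at level `a ⊔ ℓ`, but membership lives at level `ℓ`; this makes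
-- membership stable under double negation.
lowerEM : ExcludedMiddle (a ⊔ ℓ) → ExcludedMiddle ℓ
lowerEM {a = a} em {P} = map′ lower lift (em {Lift a P})

Orbit-refl : (t : Vector A n) → Orbit t t
Orbit-refl t = Perm.id , λ _ → refl

orbitOf : Vector A n → Multiset A n
orbitOf t = record { tuples = Orbit t ; isOrbit = t , (λ s → s) , (λ s → s) }

Orbit-· : (σ : Permutation′ n) (t : Vector A n) → Orbit t ≐ Orbit (σ · t)
Orbit-· σ t
  = (λ (ρ , ρt≗s) → flip σ ∘ₚ ρ , λ i → trans (cong t (inverseˡ σ)) (ρt≗s i))
  , (λ (ρ , ρσt≗s) → σ ∘ₚ ρ , ρσt≗s)

-- Stated with inclusions so that the two halves of `≐` give the two halves of `≈`, one through `σ`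
-- and the other through its inverse.
·-⊆⇒⊑ : {N : Set a} (X Y : Vector (Pred N ℓ) n) (σ : Permutation′ n) →
  Pointwise _⊆_ (σ · X) Y → X ⊑ Y
·-⊆⇒⊑ X Y σ σX⊆Y (t , t∈X , M≐t)
  = σ · t
  , (λ i → σX⊆Y i (t∈X (σ ⟨$⟩ˡ i)))
  , proj₁ (Orbit-· σ t) ∘ proj₁ M≐t
  , proj₂ M≐t ∘ proj₂ (Orbit-· σ t)

module _ (em : ExcludedMiddle (a ⊔ ℓ)) {N : Set a} where

  _⊆?_ : B.Decidable (_⊆_ {A = N} {ℓ} {ℓ})
  _ ⊆? _ = em

  -- A point of `U` outside `V` qualifies vacuously. If there is none, then `U ⊆ V` and the given
  -- point `u₀` qualifies.
  avoiding : {U : Pred N ℓ} → Satisfiable U → (V : Pred N ℓ) →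
    ∃ λ u → u ∈ U × (u ∈ V → U ⊆ V)
  avoiding {U} (u₀ , u₀∈U) V with em {∃ λ u → u ∈ U × (u ∈ V → U ⊆ V)}
  ... | yes found = found
  ... | no  none  = u₀ , u₀∈U , λ _ {u} u∈U →
    decidable-stable (lowerEM {a = a} em) λ u∉V → none (u , u∈U , λ u∈V → ⊥-elim (u∉V u∈V))

  avoidingSection : {X : Vector (Pred N ℓ) n} → All Satisfiable X → (V : Pred N ℓ) →
    ∃ λ t → t ∈ ∏ X × (∀ i → t i ∈ V → X i ⊆ V)
  avoidingSection X≠∅ V =
    proj₁ ∘ choice , proj₁ ∘ proj₂ ∘ choice , λ i → proj₂ (proj₂ (choice i))
    where choice = λ i → avoiding (X≠∅ i) V

  -- The avoiding section `t` of `X` meets `V` only where it is forced to. As `X ⊑ Y`, it is a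
  -- rearrangement of a section `s` of `Y`, and `s` has an entry in `V` at each `i` with `Y i ⊆ V`.
  ⊑⇒count-≥ : {X Y : Vector (Pred N ℓ) n} → All Satisfiable X → X ⊑ Y →
    ∀ V → count (_⊆? V) Y ℕ.≤ count (_⊆? V) X
  ⊑⇒count-≥ {X = X} {Y} X≠∅ X⊑Y V
    with t , t∈X , t∈V⇒X⊆V ← avoidingSection X≠∅ V
    with s , s∈Y , _ , s⊆t ← X⊑Y {orbitOf t} (t , t∈X , (λ r → r) , (λ r → r))
    with σ , σt≗s ← s⊆t (Orbit-refl s)
    = count-mono-permute (_⊆? V) Y X (flip σ) λ i Yᵢ⊆V →
        t∈V⇒X⊆V (σ ⟨$⟩ˡ i) (subst (_∈ V) (sym (σt≗s i)) (Yᵢ⊆V (s∈Y i)))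

proposition1 : ∀ {a ℓ : Level} → ExcludedMiddle (a ⊔ ℓ) →
    (N : Set a) (n : ℕ) (X Y : Vector (Pred N ℓ) n) →
    All Satisfiable X → All Satisfiable Y →
    (X ≈ Y) ⇔ (∃ λ (σ : Permutation′ n) → Pointwise _≐_ (σ · X) Y)
proposition1 {ℓ = ℓ} em N n X Y X≠∅ Y≠∅ = mk⇔
  (λ X≈Y → countBelow-determines (⊆-poset N ℓ) (_⊆?_ em) X Y λ V → ℕ.≤-antisym
    (⊑⇒count-≥ em Y≠∅ (λ {M} → proj₂ X≈Y {M}) V)
    (⊑⇒count-≥ em X≠∅ (λ {M} → proj₁ X≈Y {M}) V))
  (λ (σ , σX≐Y) →
    (λ {M} → ·-⊆⇒⊑ X Y σ (proj₁ ∘ σX≐Y) {M}) ,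
    -- At the index `σ ⟨$⟩ʳ i` the hypothesis concerns `X` at `σ ⟨$⟩ˡ (σ ⟨$⟩ʳ i)`, which is
    -- transported to `X i`.
    (λ {M} → ·-⊆⇒⊑ Y X (flip σ) (λ i {x} →
      subst (λ j → x ∈ X j) (inverseˡ σ) ∘ proj₂ (σX≐Y (σ ⟨$⟩ʳ i))) {M}))
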